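{- For every integer $n\ge 3$, the prism graph $P_2\,\square\,C_n$ (of order $2n$) is not orientable $\mathbb{Z}_{2n}$-distance magic.
   Context: $P_2$ is the path on 2 vertices and $C_n$ the cycle on $n$ vertices. The Cartesian product $G\,\square\,H$ has vertex set $V(G)\times V(H)$, with $(g,h)$ adjacent to $(g',h')$ iff either $g=g'$ and $h$ is adjacent to $h'$ in $H$, or $h=h'$ and $g$ is adjacent to $g'$ in $G$. For an oriented graph $\vec G$ and a vertex $x$, $N^+(x)$ is the set of vertices $y$ with an arc from $x$ to $y$, and $N^-(x)$ is the set of vertices $y$ with an arc from $y$ to $x$. For an Abelian group $\Gamma$ of order $n$, a directed $\Gamma$-distance magic labeling of an oriented graph $\vec G$ of order $n$ is a bijection $\vec l:V\to\Gamma$ such that there is $\mu\in\Gamma$ with $\sum_{y\in N^+(x)}\vec l(y)-\sum_{y\in N^-(x)}\vec l(y)=\mu$ for every vertex $x$. A simple graph $G$ of order $n$ is orientable $\Gamma$-distance magic if some orientation of its edges admits a directed $\Gamma$-distance magic labeling. $\mathbb{Z}_n$ is the cyclic group of integers modulo $n$. -}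

module Defs where

open import Algebra.Bundles using (AbelianGroup)
import Algebra.Properties.CommutativeMonoid.Sum as Sum
open import Data.Bool.Base using (if_then_else_)
open import Data.Fin.Base using (Fin; toℕ)
open import Data.Fin.Properties using (*↔×)
import Data.Integer.Base as ℤ
open import Data.Integer.Base using (ℤ; +_; 0ℤ)
open import Data.Integer.Divisibility.Signed using (_∣_; divides; ∣m∣n⇒∣m+n; ∣m⇒∣-m)
import Data.Integer.Properties as ℤ
open import Data.Integer.Tactic.RingSolver using (solve-∀)
open import Data.Nat.Base using (ℕ; suc; _*_; _≥_; s≤s)
open import Data.Nat.Properties using (1+n≢n)
open import Data.Product.Base using (Σ; _×_; _,_)
open import Data.Product.Function.NonDependent.Propositional using (_×-↔_)
open import Data.Sum.Base using (_⊎_; inj₁; inj₂)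
open import Function.Bundles using (_↔_; Inverse; Bijection)
open import Function.Construct.Composition using (_↔-∘_)
open import Function.Construct.Identity using (↔-id)
open import Level using (Level; 0ℓ; _⊔_) renaming (suc to lsuc)
open import Relation.Binary.Construct.Closure.Symmetric using (SymClosure; fwd; bwd; symmetric)
open import Relation.Binary.Core using (Rel)
open import Relation.Binary.Definitions using (Symmetric; Irreflexive; Asymmetric; Decidable)
import Relation.Binary.PropositionalEquality as ≡
open import Relation.Binary.PropositionalEquality using (_≡_; refl; trans; subst)
open import Relation.Nullary.Decidable using (does)
open import Relation.Nullary.Negation using (¬_)
import Relation.Unary as Unary

private
  variable
    c ℓ : Level

record Graph : Set₁ where
  field
    Vertex      : Set
    order       : ℕ
    enumeration : Fin order ↔ Vertex
    Adjacent    : Rel Vertex 0ℓ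
    adj-sym     : Symmetric Adjacent
    adj-irrefl  : Irreflexive _≡_ Adjacent

path : ℕ → Graph
path n = record
  { Vertex      = Fin n
  ; order       = n
  ; enumeration = ↔-id (Fin n)
  ; Adjacent    = SymClosure _⋖_
  ; adj-sym     = symmetric _⋖_
  ; adj-irrefl  = λ { refl (fwd p) → 1+n≢n p ; refl (bwd p) → 1+n≢n p }
  }
  where
  _⋖_ : Rel (Fin n) 0ℓ
  i ⋖ j = suc (toℕ i) ≡ toℕ j

CyclicSucc : ∀ n → Rel (Fin n) 0ℓ
CyclicSucc n i j = suc (toℕ i) ≡ toℕ j ⊎ (suc (toℕ i) ≡ n × toℕ j ≡ 0)

cycle : ∀ n → n ≥ 3 → Graph
cycle n n≥3 = record
  { Vertex      = Fin n
  ; order       = n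
  ; enumeration = ↔-id (Fin n)
  ; Adjacent    = SymClosure (CyclicSucc n)
  ; adj-sym     = symmetric (CyclicSucc n)
  ; adj-irrefl  = λ { refl (fwd p) → irrefl n≥3 p ; refl (bwd p) → irrefl n≥3 p }
  }
  where
  irrefl : ∀ {n} → n ≥ 3 → {i : Fin n} → ¬ CyclicSucc n i i
  irrefl _             (inj₁ p)       = 1+n≢n p
  irrefl (s≤s (s≤s _)) (inj₂ (p , q)) with () ← trans (≡.sym p) (≡.cong suc q)

infixr 7 _□_

_□_ : Graph → Graph → Graph
G □ H = record
  { Vertex      = G.Vertex × H.Vertex
  ; order       = G.order * H.order
  ; enumeration = (G.enumeration ×-↔ H.enumeration) ↔-∘ *↔×
  ; Adjacent    = λ { (g , h) (g′ , h′) →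
                      (g ≡ g′ × H.Adjacent h h′) ⊎ (h ≡ h′ × G.Adjacent g g′) }
  ; adj-sym     = λ { (inj₁ (p , e)) → inj₁ (≡.sym p , H.adj-sym e)
                    ; (inj₂ (p , e)) → inj₂ (≡.sym p , G.adj-sym e) }
  ; adj-irrefl  = λ { refl (inj₁ (_ , e)) → H.adj-irrefl refl e
                    ; refl (inj₂ (_ , e)) → G.adj-irrefl refl e }
  }
  where
  module G = Graph G
  module H = Graph H

-- Decidability of arcs lets one sum over in- and out-neighbourhoods; on a
-- finite vertex set it is no restriction classically.
record Orientation (G : Graph) : Set₁ where
  open Graph G
  field
    Arc      : Rel Vertex 0ℓ
    arc?     : Decidable Arc
    arc⇒adj  : ∀ {x y} → Arc x y → Adjacent x y
    adj⇒arc  : ∀ {x y} → Adjacent x y → Arc x y ⊎ Arc y x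
    arc-asym : Asymmetric Arc

  N⁺ N⁻ : Vertex → Unary.Pred Vertex 0ℓ
  N⁺ x y = Arc x y
  N⁻ x y = Arc y x

  N⁺? : ∀ x → Unary.Decidable (N⁺ x)
  N⁺? x y = arc? x y

  N⁻? : ∀ x → Unary.Decidable (N⁻ x)
  N⁻? x y = arc? y x

module _ (Γ : AbelianGroup c ℓ) where
  open AbelianGroup Γ using (Carrier; _≈_; _-_; ε; setoid; commutativeMonoid)
  open Sum commutativeMonoid using (sum-syntax)

  sumOver : (G : Graph) {P : Unary.Pred (Graph.Vertex G) 0ℓ} →
            Unary.Decidable P → (Graph.Vertex G → Carrier) → Carrier
  sumOver G P? f = ∑[ i < order ] (if does (P? (vertex i)) then f (vertex i) else ε)
    where
    open Graph G
    vertex = Inverse.to enumeration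

  -- A bijection from the vertices onto Γ exists only if the order of Γ is that
  -- of the graph, so this requirement is not repeated as a field.
  record DirectedDistanceMagicLabeling {G : Graph} (D : Orientation G) : Set (c ⊔ ℓ) where
    open Graph G
    open Orientation D
    field
      labeling : Bijection (≡.setoid Vertex) setoid
      μ        : Carrier

    label : Vertex → Carrier
    label = Bijection.to labeling

    field
      magic : ∀ x → sumOver G (N⁺? x) label - sumOver G (N⁻? x) label ≈ μ

  OrientableDistanceMagic : Graph → Set (lsuc 0ℓ ⊔ c ⊔ ℓ)
  OrientableDistanceMagic G = Σ (Orientation G) DirectedDistanceMagicLabeling

-- The quotient of ℤ by n is presented as a setoid on ℤ.
ℤ/_ : ℕ → AbelianGroup 0ℓ 0ℓ
ℤ/ n = record
  { Carrier = ℤ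
  ; _≈_     = _≈_
  ; _∙_     = ℤ._+_
  ; ε       = 0ℤ
  ; _⁻¹     = ℤ.-_
  ; isAbelianGroup = record
    { isGroup = record
      { isMonoid = record
        { isSemigroup = record
          { isMagma = record
            { isEquivalence = record
              { refl  = λ {x} → reflexive {x} refl
              ; sym   = λ {x y} p → subst (+ n ∣_) (neg-diff x y) (∣m⇒∣-m p)
              ; trans = λ {x y z} p q → subst (+ n ∣_) (add-diff x y z) (∣m∣n⇒∣m+n p q)
              }
            ; ∙-cong = λ {x y u v} p q → subst (+ n ∣_) (diff-add x y u v) (∣m∣n⇒∣m+n p q)
            }
          ; assoc = λ x y z → reflexive (ℤ.+-assoc x y z)
          }
        ; identity = (λ x → reflexive (ℤ.+-identityˡ x)) , (λ x → reflexive (ℤ.+-identityʳ x))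
        }
      ; inverse = (λ x → reflexive (ℤ.+-inverseˡ x)) , (λ x → reflexive (ℤ.+-inverseʳ x))
      ; ⁻¹-cong = λ {x y} p → subst (+ n ∣_) (diff-neg x y) (∣m⇒∣-m p)
      }
    ; comm = λ x y → reflexive (ℤ.+-comm x y)
    }
  }
  where
  _≈_ : Rel ℤ 0ℓ
  x ≈ y = + n ∣ x ℤ.- y

  reflexive : ∀ {x y} → x ≡ y → x ≈ y
  reflexive {x} refl = divides 0ℤ (ℤ.+-inverseʳ x)

  neg-diff : ∀ x y → ℤ.- (x ℤ.- y) ≡ y ℤ.- x
  neg-diff = solve-∀

  add-diff : ∀ x y z → (x ℤ.- y) ℤ.+ (y ℤ.- z) ≡ x ℤ.- z
  add-diff = solve-∀

  diff-add : ∀ x y u v → (x ℤ.- y) ℤ.+ (u ℤ.- v) ≡ (x ℤ.+ u) ℤ.- (y ℤ.+ v)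
  diff-add = solve-∀

  diff-neg : ∀ x y → ℤ.- (x ℤ.- y) ≡ (ℤ.- x) ℤ.- (ℤ.- y)
  diff-neg = solve-∀

{-# OPTIONS --safe #-}
module Submission where

-- Let t(x) ∈ {0, 1} be the parity of the label of x, and T(x) the sum of t over
-- the three neighbours of x; modulo 2 signs do not matter, so T(x) ≡ μ for every
-- x. Write R for the rotation and F for the exchange of the two copies of the
-- cycle. The vertices x and F(R x) share two neighbours, so T(x) and T(F(R x))
-- differ by a difference of two bits that is even, hence they are equal.
-- Therefore T(x) + T(F x) is a constant c, which is even. Half of the labels are
-- odd, and each is counted by three neighbours, so the average of T is 3/2, and
-- c = 3, a contradiction.

open import Defs
open import Algebra.Bundles using (AbelianGroup)
import Algebra.Properties.CommutativeMonoid.Sum as Sum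
open import Data.Bool.Base using (if_then_else_)
open import Data.Empty using (⊥)
open import Data.Fin.Base using (Fin; zero; suc; fromℕ; inject₁; opposite)
open import Data.Fin.Induction using (<-weakInduction)
open import Data.Fin.Properties using (_≟_; toℕ-injective; toℕ-fromℕ; toℕ-inject₁;
  toℕ<n; opposite-involutive)
open import Data.Fin.Relation.Unary.Top using (view; ‵fromℕ; ‵inject₁)
open import Data.Integer.Base using (ℤ; +_; 0ℤ; 1ℤ; -1ℤ; _+_; _-_) renaming (_*_ to _*ᶻ_)
open import Data.Integer.DivMod using (_/ℕ_; _%ℕ_; n%ℕd<d; a≡a%ℕn+[a/ℕn]*n)
open import Data.Integer.Divisibility.Signed using (_∣_; _∣?_; ∣-trans; ∣m∣n⇒∣m+n; ∣m∣n⇒∣m-n;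
  ∣m⇒∣m*n; ∣n⇒∣m*n; ∣-refl; ∣m⇒∣-m)
open import Data.Integer.Properties using (+-0-commutativeMonoid; +-comm; *-cancelˡ-≡; *-identityʳ;
  +-identityˡ; +-identityʳ; pos-*)
open import Data.Integer.Tactic.RingSolver using (solve-∀)
open import Data.Nat.Base as ℕ using (ℕ; _*_; _≥_; s≤s)
import Data.Nat.Properties as ℕ
open import Data.Product.Base using (_,_; proj₁; proj₂)
open import Data.Sum.Base using (_⊎_; inj₁; inj₂)
open import Function.Base using (_∘_)
open import Function.Bundles using (_↔_; Inverse; Bijection; mk↔ₛ′)
open import Function.Construct.Composition using (_↔-∘_)
open import Function.Construct.Symmetry using (↔-sym)
open import Relation.Binary.Construct.Closure.Symmetric using (fwd; bwd)
open import Relation.Binary.PropositionalEquality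
open import Relation.Nullary.Decidable using (yes; no; does; dec-true; dec-false; from-no)
open import Relation.Nullary.Negation using (¬_; contradiction)

open Sum +-0-commutativeMonoid using (sum; sum-cong-≗; sum-permute; ∑-distrib-+; sum-replicate-zero)

-- Parity of integers.

bit half : ℤ → ℤ
bit z = + (z %ℕ 2)
half z = z /ℕ 2

bit+2*half : ∀ z → z ≡ bit z + half z *ᶻ + 2
bit+2*half z = a≡a%ℕn+[a/ℕn]*n z 2

2∤1 : ¬ + 2 ∣ 1ℤ
2∤1 = from-no (+ 2 ∣? 1ℤ)

<2-cong⇒≡ : ∀ {m n} → m ℕ.< 2 → n ℕ.< 2 → + 2 ∣ + m - + n → m ≡ n
<2-cong⇒≡ {0} {0} _ _ _ = refl
<2-cong⇒≡ {1} {1} _ _ _ = refl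
<2-cong⇒≡ {0} {1} _ _ d = contradiction (∣m⇒∣-m d) 2∤1
<2-cong⇒≡ {1} {0} _ _ d = contradiction d 2∤1
<2-cong⇒≡ {ℕ.2+ _} (s≤s (s≤s ())) _ _
<2-cong⇒≡ {_} {ℕ.2+ _} _ (s≤s (s≤s ())) _

bits-cong⇒≡ : ∀ z w → + 2 ∣ bit z - bit w → bit z ≡ bit w
bits-cong⇒≡ z w d = cong +_ (<2-cong⇒≡ (n%ℕd<d z 2) (n%ℕd<d w 2) d)

<2-opposite : ∀ {m n} → m ℕ.< 2 → n ℕ.< 2 → + 2 ∣ + m - (+ n + 1ℤ) → m ℕ.+ n ≡ 1
<2-opposite {0} {0} _ _ d = contradiction (∣m⇒∣-m d) 2∤1
<2-opposite {1} {1} _ _ d = contradiction (∣m⇒∣-m d) 2∤1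
<2-opposite {0} {1} _ _ _ = refl
<2-opposite {1} {0} _ _ _ = refl
<2-opposite {ℕ.2+ _} (s≤s (s≤s ())) _ _
<2-opposite {_} {ℕ.2+ _} _ (s≤s (s≤s ())) _

-- Removing the even number `(half z - half w) *ᶻ + 2` from the hypothesis leaves the same
-- congruence between the two bits, where it can be decided by cases.
bit-suc : ∀ z w → + 2 ∣ z - (w + 1ℤ) → bit z + bit w ≡ 1ℤ
bit-suc z w d = cong +_ (<2-opposite (n%ℕd<d z 2) (n%ℕd<d w 2)
  (subst (+ 2 ∣_) eq (∣m∣n⇒∣m-n d (∣n⇒∣m*n (half z - half w) ∣-refl))))
  where
  rearrange : ∀ a b h k → ((a + h *ᶻ + 2) - ((b + k *ᶻ + 2) + 1ℤ)) - (h - k) *ᶻ + 2 ≡ a - (b + 1ℤ)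
  rearrange = solve-∀
  eq : (z - (w + 1ℤ)) - (half z - half w) *ᶻ + 2 ≡ bit z - (bit w + 1ℤ)
  eq = trans (cong₂ (λ u v → (u - (v + 1ℤ)) - (half z - half w) *ᶻ + 2) (bit+2*half z) (bit+2*half w))
             (rearrange (bit z) (bit w) (half z) (half w))

-- Sums over indices and over vertices.

sum-const : ∀ n c → sum {n} (λ _ → c) ≡ + n *ᶻ c
sum-const ℕ.zero    c = refl
sum-const (ℕ.suc n) c = trans (cong (λ s → c + s) (sum-const n c)) (fold (+ n) c)
  where
  fold : ∀ k c → c + k *ᶻ c ≡ (1ℤ + k) *ᶻ c
  fold = solve-∀

sum-δ : ∀ {n} (i : Fin n) (f : Fin n → ℤ) → sum (λ j → if does (i ≟ j) then f j else 0ℤ) ≡ f i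
sum-δ {ℕ.suc n} zero    f = trans (cong (λ s → f zero + s) (sum-replicate-zero n)) (+-identityʳ (f zero))
sum-δ           (suc i) f = trans (+-identityˡ _) (sum-δ i (f ∘ suc))

module VertexSum (G : Graph) where
  open Graph G

  vertex = Inverse.to enumeration
  index = Inverse.from enumeration

  vertex-index : ∀ x → vertex (index x) ≡ x
  vertex-index = Inverse.strictlyInverseˡ enumeration

  index-vertex : ∀ i → index (vertex i) ≡ i
  index-vertex = Inverse.strictlyInverseʳ enumeration

  index-injective : ∀ {x y} → index x ≡ index y → x ≡ y
  index-injective {x} {y} p = trans (sym (vertex-index x)) (trans (cong vertex p) (vertex-index y))

  sumᵛ : (Vertex → ℤ) → ℤ
  sumᵛ f = sum (λ i → f (vertex i))

  sumᵛ-cong : ∀ {f g} → f ≗ g → sumᵛ f ≡ sumᵛ g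
  sumᵛ-cong f≗g = sum-cong-≗ (λ i → f≗g (vertex i))

  sumᵛ-distrib-+ : ∀ f g → sumᵛ (λ x → f x + g x) ≡ sumᵛ f + sumᵛ g
  sumᵛ-distrib-+ f g = ∑-distrib-+ (f ∘ vertex) (g ∘ vertex)

  -- Conjugating `π` by the enumeration gives a permutation of the indices, to which `sum-permute`
  -- applies.
  sumᵛ-permute : ∀ f (π : Vertex ↔ Vertex) → sumᵛ (f ∘ Inverse.to π) ≡ sumᵛ f
  sumᵛ-permute f π = sym (trans
    (sum-permute (f ∘ vertex) (↔-sym enumeration ↔-∘ (π ↔-∘ enumeration)))
    (sum-cong-≗ (λ i → cong f (vertex-index (Inverse.to π (vertex i))))))

  sumᵛ-δ : ∀ x (f : Vertex → ℤ) → sum (λ i → if does (index x ≟ i) then f (vertex i) else 0ℤ) ≡ f x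
  sumᵛ-δ x f = trans (sum-δ (index x) (f ∘ vertex)) (cong f (vertex-index x))

-- Signless magic sums at a vertex of degree three.

record HasNeighbours (G : Graph) (x a b c : Graph.Vertex G) : Set where
  open Graph G
  field
    a≢b : a ≢ b
    a≢c : a ≢ c
    b≢c : b ≢ c
    adj-a : Adjacent x a
    adj-b : Adjacent x b
    adj-c : Adjacent x c
    neighbour : ∀ {y} → Adjacent x y → y ≡ a ⊎ y ≡ b ⊎ y ≡ c

module _ {G : Graph} (D : Orientation G) where
  open Graph G
  open Orientation D
  open VertexSum G

  -- By asymmetry the edge is oriented in exactly one direction, so exactly one of the two terms
  -- survives.
  arcTerms-adj : ∀ {x y} w → Adjacent x y →
    (if does (arc? x y) then w else 0ℤ) + (if does (arc? y x) then w else 0ℤ) ≡ w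
  arcTerms-adj {x} {y} w e with adj⇒arc e
  ... | inj₁ p rewrite dec-true (arc? x y) p | dec-false (arc? y x) (arc-asym p) = +-identityʳ w
  ... | inj₂ p rewrite dec-true (arc? y x) p | dec-false (arc? x y) (arc-asym p) = +-identityˡ w

  arcTerms-nonadj : ∀ {x y} w → ¬ Adjacent x y →
    (if does (arc? x y) then w else 0ℤ) + (if does (arc? y x) then w else 0ℤ) ≡ 0ℤ
  arcTerms-nonadj {x} {y} w ¬e
    rewrite dec-false (arc? x y) (λ p → ¬e (arc⇒adj p))
          | dec-false (arc? y x) (λ p → ¬e (adj-sym (arc⇒adj p))) = refl

  module _ {x a b c} (N : HasNeighbours G x a b c) (f : Vertex → ℤ) where
    open HasNeighbours N

    arcTerms : ∀ i → let y = vertex i in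
      (if does (arc? x y) then f y else 0ℤ) + (if does (arc? y x) then f y else 0ℤ)
      ≡ ((if does (index a ≟ i) then f y else 0ℤ) + (if does (index b ≟ i) then f y else 0ℤ))
        + (if does (index c ≟ i) then f y else 0ℤ)
    arcTerms i with index a ≟ i | index b ≟ i | index c ≟ i
    -- As `a`, `b` and `c` are distinct, at most one indicator on the right is nonzero.
    ... | yes p | yes q | _     = contradiction (index-injective (trans p (sym q))) a≢b
    ... | yes p | _     | yes r = contradiction (index-injective (trans p (sym r))) a≢c
    ... | _     | yes q | yes r = contradiction (index-injective (trans q (sym r))) b≢c
    ... | yes refl | no _ | no _ = trans
      (arcTerms-adj _ (subst (Adjacent x) (sym (vertex-index a)) adj-a))
      (sym (trans (+-identityʳ _) (+-identityʳ _)))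
    ... | no _ | yes refl | no _ = trans
      (arcTerms-adj _ (subst (Adjacent x) (sym (vertex-index b)) adj-b))
      (sym (trans (+-identityʳ _) (+-identityˡ _)))
    ... | no _ | no _ | yes refl = trans
      (arcTerms-adj _ (subst (Adjacent x) (sym (vertex-index c)) adj-c))
      (sym (+-identityˡ _))
    ... | no p | no q | no r = arcTerms-nonadj _ λ e → absurd (neighbour e)
      where
      absurd : vertex i ≡ a ⊎ vertex i ≡ b ⊎ vertex i ≡ c → ⊥
      absurd (inj₁ refl)        = p (index-vertex i)
      absurd (inj₂ (inj₁ refl)) = q (index-vertex i)
      absurd (inj₂ (inj₂ refl)) = r (index-vertex i)

    -- Adding the two sums instead of subtracting them removes the dependence on the orientation.
    -- The equation is exact, not a congruence modulo `m`, because `ℤ/ m` adds its representatives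
    -- in ℤ.
    sumOver-N⁺+N⁻ : ∀ m →
      sumOver (ℤ/ m) G (N⁺? x) f + sumOver (ℤ/ m) G (N⁻? x) f ≡ (f a + f b) + f c
    sumOver-N⁺+N⁻ m = begin
      sum outward + sum inward
        ≡⟨ ∑-distrib-+ outward inward ⟨
      sum (λ i → outward i + inward i)
        ≡⟨ sum-cong-≗ arcTerms ⟩
      sum (λ i → (δ a i + δ b i) + δ c i)
        ≡⟨ ∑-distrib-+ (λ i → δ a i + δ b i) (δ c) ⟩
      sum (λ i → δ a i + δ b i) + sum (δ c)
        ≡⟨ cong (_+ sum (δ c)) (∑-distrib-+ (δ a) (δ b)) ⟩
      (sum (δ a) + sum (δ b)) + sum (δ c)
        ≡⟨ cong₂ _+_ (cong₂ _+_ (sumᵛ-δ a f) (sumᵛ-δ b f)) (sumᵛ-δ c f) ⟩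
      (f a + f b) + f c ∎
      where
      open ≡-Reasoning
      outward inward : Fin order → ℤ
      outward i = if does (arc? x (vertex i)) then f (vertex i) else 0ℤ
      inward i = if does (arc? (vertex i) x) then f (vertex i) else 0ℤ
      δ : Vertex → Fin order → ℤ
      δ z i = if does (index z ≟ i) then f (vertex i) else 0ℤ

-- Parities of the labels.

module Parity {G : Graph} {D : Orientation G} (n : ℕ)
              (L : DirectedDistanceMagicLabeling (ℤ/ (2 * n)) D) where
  open Graph G
  open Orientation D
  open VertexSum G
  open DirectedDistanceMagicLabeling L
  open AbelianGroup (ℤ/ (2 * n)) using (_≈_)

  t : Vertex → ℤ
  t x = bit (label x)

  -- This weakens congruences modulo `2 * n` to congruences modulo 2, so parity depends only on the
  -- class of a label.
  2∣2n : + 2 ∣ + (2 * n)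
  2∣2n = subst (+ 2 ∣_) (sym (pos-* 2 n)) (∣m⇒∣m*n (+ n) ∣-refl)

  unlabel : ℤ → Vertex
  unlabel z = proj₁ (Bijection.surjective labeling z)

  label-unlabel : ∀ z → label (unlabel z) ≈ z
  label-unlabel z = proj₂ (Bijection.surjective labeling z) refl

  -- The translation by `k` in the group, transported to the vertices along the labeling.
  shift : ℤ → Vertex → Vertex
  shift k x = unlabel (label x + k)

  shift-shift : ∀ {k j} → k + j ≡ 0ℤ → ∀ x → shift k (shift j x) ≡ x
  shift-shift {k} {j} k+j≡0 x = Bijection.injective labeling
    (subst (+ (2 * n) ∣_) eq
      (∣m∣n⇒∣m+n (label-unlabel (label (shift j x) + k)) (label-unlabel (label x + j))))
    where
    rearrange : ∀ a b c k j → (a - (b + k)) + (b - (c + j)) ≡ (a - c) - (k + j)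
    rearrange = solve-∀
    eq : (label (shift k (shift j x)) - (label (shift j x) + k)) + (label (shift j x) - (label x + j))
         ≡ label (shift k (shift j x)) - label x
    eq = trans (rearrange (label (shift k (shift j x))) (label (shift j x)) (label x) k j)
               (trans (cong (λ s → (label (shift k (shift j x)) - label x) - s) k+j≡0) (+-identityʳ _))

  shift↔ : Vertex ↔ Vertex
  shift↔ = mk↔ₛ′ (shift 1ℤ) (shift -1ℤ) (shift-shift refl) (shift-shift refl)

  -- The modulus is even, so adding 1 flips the parity even when the label wraps around.
  t-shift : ∀ x → t (shift 1ℤ x) + t x ≡ 1ℤ
  t-shift x = bit-suc (label (shift 1ℤ x)) (label x) (∣-trans 2∣2n (label-unlabel (label x + 1ℤ)))

  -- Adding 1 to the labels permutes the vertices and exchanges the parities.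
  2*sumᵛ-t : sumᵛ t + sumᵛ t ≡ + order
  2*sumᵛ-t = begin
    sumᵛ t + sumᵛ t                      ≡⟨ cong (_+ sumᵛ t) (sumᵛ-permute t shift↔) ⟨
    sumᵛ (t ∘ shift 1ℤ) + sumᵛ t         ≡⟨ sumᵛ-distrib-+ (t ∘ shift 1ℤ) t ⟨
    sumᵛ (λ x → t (shift 1ℤ x) + t x)    ≡⟨ sumᵛ-cong t-shift ⟩
    sumᵛ (λ _ → 1ℤ)                      ≡⟨ sum-const order 1ℤ ⟩
    + order *ᶻ 1ℤ                        ≡⟨ *-identityʳ (+ order) ⟩
    + order                              ∎
    where open ≡-Reasoning

  -- Modulo 2 the difference of the out-sum and the in-sum agrees with their sum, and every label
  -- agrees with its bit.
  t-neighbours : ∀ {x a b c} → HasNeighbours G x a b c → + 2 ∣ ((t a + t b) + t c) - μ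
  t-neighbours {x} {a} {b} {c} N = subst (+ 2 ∣_) eq
    (∣m∣n⇒∣m+n (∣-trans 2∣2n (magic x)) (∣n⇒∣m*n k ∣-refl))
    where
    p m k : ℤ
    p = sumOver (ℤ/ (2 * n)) G (N⁺? x) label
    m = sumOver (ℤ/ (2 * n)) G (N⁻? x) label
    -- Adding `2 * m` turns `p - m` into `p + m`; subtracting twice the halves turns the three
    -- labels into their bits.
    k = m - ((half (label a) + half (label b)) + half (label c))
    step₁ : ∀ p m μ h → ((p - m) - μ) + (m - h) *ᶻ + 2 ≡ (p + m) - μ - h *ᶻ + 2
    step₁ = solve-∀
    step₂ : ∀ a b c f g h μ →
      (((a + f *ᶻ + 2) + (b + g *ᶻ + 2)) + (c + h *ᶻ + 2)) - μ - ((f + g) + h) *ᶻ + 2 ≡ ((a + b) + c) - μ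
    step₂ = solve-∀
    eq : ((p - m) - μ) + k *ᶻ + 2 ≡ ((t a + t b) + t c) - μ
    eq = trans (step₁ p m μ _) (trans
      (cong (λ s → s - μ - ((half (label a) + half (label b)) + half (label c)) *ᶻ + 2)
        (trans (sumOver-N⁺+N⁻ D N label (2 * n))
          (cong₂ _+_ (cong₂ _+_ (bit+2*half (label a)) (bit+2*half (label b))) (bit+2*half (label c)))))
      (step₂ (t a) (t b) (t c) (half (label a)) (half (label b)) (half (label c)) μ))

-- Successors on the cycle and the exchange of the two path vertices.

CyclicSucc-unique : ∀ {n} {i j k : Fin n} → CyclicSucc n i j → CyclicSucc n i k → j ≡ k
CyclicSucc-unique (inj₁ p)       (inj₁ q)       = toℕ-injective (trans (sym p) q)
CyclicSucc-unique (inj₂ (_ , p)) (inj₂ (_ , q)) = toℕ-injective (trans p (sym q))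
CyclicSucc-unique {j = j} (inj₁ p) (inj₂ (q , _)) = contradiction (trans (sym p) q) (ℕ.<⇒≢ (toℕ<n j))
CyclicSucc-unique {k = k} (inj₂ (q , _)) (inj₁ p) = contradiction (trans (sym p) q) (ℕ.<⇒≢ (toℕ<n k))

CyclicSucc-injective : ∀ {n} {i j k : Fin n} → CyclicSucc n i k → CyclicSucc n j k → i ≡ j
CyclicSucc-injective (inj₁ p)       (inj₁ q)       = toℕ-injective (ℕ.suc-injective (trans p (sym q)))
CyclicSucc-injective (inj₂ (p , _)) (inj₂ (q , _)) = toℕ-injective (ℕ.suc-injective (trans p (sym q)))
CyclicSucc-injective (inj₁ p) (inj₂ (_ , q)) with () ← trans p q
CyclicSucc-injective (inj₂ (_ , q)) (inj₁ p) with () ← trans p q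

module _ {m : ℕ} where

  next prev : Fin (ℕ.suc m) → Fin (ℕ.suc m)
  next i with view i
  ... | ‵fromℕ     = zero
  ... | ‵inject₁ j = suc j
  prev zero    = fromℕ m
  prev (suc i) = inject₁ i

  CyclicSucc-next : ∀ i → CyclicSucc (ℕ.suc m) i (next i)
  CyclicSucc-next i with view i
  ... | ‵fromℕ     = inj₂ (cong ℕ.suc (toℕ-fromℕ m) , refl)
  ... | ‵inject₁ j = inj₁ (cong ℕ.suc (toℕ-inject₁ j))

  CyclicSucc-prev : ∀ i → CyclicSucc (ℕ.suc m) (prev i) i
  CyclicSucc-prev zero    = inj₂ (cong ℕ.suc (toℕ-fromℕ m) , refl)
  CyclicSucc-prev (suc i) = inj₁ (cong ℕ.suc (toℕ-inject₁ i))

  -- Both sides are cyclic successors of `prev i`, so no case analysis on the wrap-around is needed.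
  next-prev : ∀ i → next (prev i) ≡ i
  next-prev i = CyclicSucc-unique (CyclicSucc-next (prev i)) (CyclicSucc-prev i)

  prev-next : ∀ i → prev (next i) ≡ i
  prev-next i = CyclicSucc-injective (CyclicSucc-prev (next i)) (CyclicSucc-next i)

-- Otherwise `i` and `next i` would be cyclic successors of each other. Without a wrap-around this
-- violates the order, one wrap-around forces `m` to be 1, and two force it to be 0.
next≢prev : ∀ {m} → 2 ℕ.≤ m → (i : Fin (ℕ.suc m)) → next i ≢ prev i
next≢prev {m} 2≤m i p = no-2-cycle (CyclicSucc-next i)
  (subst (λ j → CyclicSucc (ℕ.suc m) j i) (sym p) (CyclicSucc-prev i))
  where
  no-2-cycle : ∀ {i j : Fin (ℕ.suc m)} → CyclicSucc (ℕ.suc m) i j → ¬ CyclicSucc (ℕ.suc m) j i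
  no-2-cycle (inj₁ p) (inj₁ q) = ℕ.<-asym (ℕ.≤-reflexive p) (ℕ.≤-reflexive q)
  no-2-cycle (inj₁ p) (inj₂ (q , r)) = ℕ.<⇒≢ 2≤m (trans (sym (trans (sym p) (cong ℕ.suc r))) (ℕ.suc-injective q))
  no-2-cycle (inj₂ (q , r)) (inj₁ p) = ℕ.<⇒≢ 2≤m (trans (sym (trans (sym p) (cong ℕ.suc r))) (ℕ.suc-injective q))
  no-2-cycle (inj₂ (q , _)) (inj₂ (_ , r)) = ℕ.<⇒≢ (ℕ.<-trans ℕ.0<1+n 2≤m) (trans (sym r) (ℕ.suc-injective q))

path2-Adjacent⇒opposite : ∀ {g h} → Graph.Adjacent (path 2) g h → h ≡ opposite g
path2-Adjacent⇒opposite {zero}     {suc zero} _ = refl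
path2-Adjacent⇒opposite {suc zero} {zero}     _ = refl
path2-Adjacent⇒opposite {zero}     {zero}     e = contradiction e (Graph.adj-irrefl (path 2) refl)
path2-Adjacent⇒opposite {suc zero} {suc zero} e = contradiction e (Graph.adj-irrefl (path 2) refl)

path2-Adjacent-opposite : ∀ g → Graph.Adjacent (path 2) g (opposite g)
path2-Adjacent-opposite zero       = fwd refl
path2-Adjacent-opposite (suc zero) = bwd refl

opposite≢ : ∀ (g : Fin 2) → g ≢ opposite g
opposite≢ zero       ()
opposite≢ (suc zero) ()

-- The prism and its symmetries.

module Prism {m : ℕ} (2≤m : 2 ℕ.≤ m) where

  prism : Graph
  prism = path 2 □ cycle (ℕ.suc m) (s≤s 2≤m)

  open Graph prism
  open VertexSum prism

  R L F : Vertex → Vertex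
  R (g , i) = g , next i
  L (g , i) = g , prev i
  F (g , i) = opposite g , i

  R↔ L↔ F↔ : Vertex ↔ Vertex
  R↔ = mk↔ₛ′ R L (λ (g , i) → cong (g ,_) (next-prev i)) (λ (g , i) → cong (g ,_) (prev-next i))
  L↔ = ↔-sym R↔
  F↔ = mk↔ₛ′ F F FF FF
    where
    FF : ∀ x → F (F x) ≡ x
    FF (g , i) = cong (_, i) (opposite-involutive g)

  -- Cycle length at least three separates `R x` from `L x`; `F x` lies in the other copy of the
  -- cycle.
  neighbours : ∀ x → HasNeighbours prism x (R x) (L x) (F x)
  neighbours x@(g , i) = record
    { a≢b = λ p → next≢prev 2≤m i (cong proj₂ p)
    ; a≢c = λ p → opposite≢ g (cong proj₁ p)
    ; b≢c = λ p → opposite≢ g (cong proj₁ p)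
    ; adj-a = inj₁ (refl , fwd (CyclicSucc-next i))
    ; adj-b = inj₁ (refl , bwd (CyclicSucc-prev i))
    ; adj-c = inj₂ (refl , path2-Adjacent-opposite g)
    ; neighbour = λ
      { (inj₁ (refl , fwd s)) → inj₁ (cong (g ,_) (CyclicSucc-unique s (CyclicSucc-next i)))
      ; (inj₁ (refl , bwd s)) → inj₂ (inj₁ (cong (g ,_) (CyclicSucc-injective s (CyclicSucc-prev i))))
      ; (inj₂ (refl , e))     → inj₂ (inj₂ (cong (_, i) (path2-Adjacent⇒opposite e)))
      }
    }

  -- `R` is transitive on each copy of the cycle and `F` joins the two copies.
  invariant⇒constant : ∀ (f : Vertex → ℤ) → (∀ x → f x ≡ f (R x)) → (∀ x → f x ≡ f (F x)) →
                       ∀ x → f x ≡ f (zero , zero)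
  invariant⇒constant f f-R f-F (g , i) = trans
    (<-weakInduction (λ j → f (g , j) ≡ f (g , zero)) refl
      -- `prev (suc j)` is `inject₁ j` by definition, so `suc j` is the rotation of `inject₁ j`.
      (λ j p → trans (trans (cong (λ k → f (g , k)) (sym (next-prev (suc j)))) (sym (f-R (g , inject₁ j)))) p) i)
    (row g)
    where
    row : ∀ g → f (g , zero) ≡ f (zero , zero)
    row zero       = refl
    row (suc zero) = sym (f-F (zero , zero))

  -- Neighbourhood sums of parities and the contradiction.

  module _ {D : Orientation prism} (ℓ : DirectedDistanceMagicLabeling (ℤ/ (2 * ℕ.suc m)) D) where
    open Parity (ℕ.suc m) ℓ using (t; 2*sumᵛ-t; t-neighbours)
    open DirectedDistanceMagicLabeling ℓ using (label; μ)
    open ≡-Reasoning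

    -- These are integer sums of bits, not residues: the averaging argument needs their exact
    -- values.
    T C : Vertex → ℤ
    T x = (t (R x) + t (L x)) + t (F x)
    C x = T x + T (F x)

    t-FF : ∀ x → t (F (F x)) ≡ t x
    t-FF x = cong t (Inverse.strictlyInverseˡ F↔ x)

    T-FF : ∀ x → T (F (F x)) ≡ T x
    T-FF x = cong T (Inverse.strictlyInverseˡ F↔ x)

    -- Since `L` undoes `R` and `F` is an involution, `F x` and `R x` appear here as neighbours of
    -- `F (R x)`; they are also neighbours of `x`.
    T-FR-expand : ∀ x → T (F (R x)) ≡ (t (F (R (R x))) + t (F x)) + t (R x)
    T-FR-expand x = cong₂ (λ u v → (t (F (R (R x))) + u) + v)
      (cong (t ∘ F) (Inverse.strictlyInverseʳ R↔ x)) (t-FF (R x))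

    T-FR : ∀ x → T x ≡ T (F (R x))
    T-FR x = begin
      (t (R x) + t (L x)) + t (F x)         ≡⟨ cong (λ u → (t (R x) + u) + t (F x)) tL≡tFRR ⟩
      (t (R x) + t (F (R (R x)))) + t (F x) ≡⟨ permute (t (R x)) (t (F (R (R x)))) (t (F x)) ⟩
      (t (F (R (R x))) + t (F x)) + t (R x) ≡⟨ T-FR-expand x ⟨
      T (F (R x))                           ∎
      where
      permute : ∀ a b c → (a + b) + c ≡ (b + c) + a
      permute = solve-∀
      cancel : ∀ a b c d μ → (((a + b) + c) - μ) - (((d + c) + a) - μ) ≡ b - d
      cancel = solve-∀
      tL≡tFRR : t (L x) ≡ t (F (R (R x)))
      -- Subtracting the congruences at `x` and at `F (R x)` cancels `μ` and the shared neighbours,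
      -- leaving an even difference of two bits.
      tL≡tFRR = bits-cong⇒≡ (label (L x)) (label (F (R (R x)))) (subst (+ 2 ∣_)
        (trans (cong (λ s → (T x - μ) - (s - μ)) (T-FR-expand x))
               (cancel (t (R x)) (t (L x)) (t (F x)) (t (F (R (R x)))) μ))
        (∣m∣n⇒∣m-n (t-neighbours (neighbours x)) (t-neighbours (neighbours (F (R x))))))

    C-F : ∀ x → C x ≡ C (F x)
    C-F x = trans (+-comm (T x) (T (F x))) (cong (λ s → T (F x) + s) (sym (T-FF x)))

    -- Applying `T-FR` at `x` and at `F x` turns the two summands into those of `C (R x)` in the
    -- opposite order; `R` and `F` commute by computation.
    C-R : ∀ x → C x ≡ C (R x)
    C-R x = begin
      T x + T (F x)                 ≡⟨ cong₂ _+_ (T-FR x) (trans (T-FR (F x)) (T-FF (R x))) ⟩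
      T (F (R x)) + T (R x)         ≡⟨ +-comm (T (F (R x))) (T (R x)) ⟩
      T (R x) + T (F (R x))         ∎

    c : ℤ
    c = C (zero , zero)

    -- Each of `R`, `L` and `F` permutes the vertices, so every parity is counted three times.
    sumᵛ-T : sumᵛ T ≡ (sumᵛ t + sumᵛ t) + sumᵛ t
    sumᵛ-T = begin
      sumᵛ T
        ≡⟨ sumᵛ-distrib-+ (λ x → t (R x) + t (L x)) (t ∘ F) ⟩
      sumᵛ (λ x → t (R x) + t (L x)) + sumᵛ (t ∘ F)
        ≡⟨ cong (_+ sumᵛ (t ∘ F)) (sumᵛ-distrib-+ (t ∘ R) (t ∘ L)) ⟩
      (sumᵛ (t ∘ R) + sumᵛ (t ∘ L)) + sumᵛ (t ∘ F)
        ≡⟨ cong₂ _+_ (cong₂ _+_ (sumᵛ-permute t R↔) (sumᵛ-permute t L↔)) (sumᵛ-permute t F↔) ⟩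
      (sumᵛ t + sumᵛ t) + sumᵛ t ∎

    c≡3 : c ≡ + 3
    -- The order reduces to a successor, so it is nonzero and cancels once `C` has been summed over
    -- all vertices in two ways.
    c≡3 = *-cancelˡ-≡ (+ order) c (+ 3) (begin
      + order *ᶻ c                         ≡⟨ sum-const order c ⟨
      sumᵛ (λ _ → c)                       ≡⟨ sumᵛ-cong (invariant⇒constant C C-R C-F) ⟨
      sumᵛ C                               ≡⟨ sumᵛ-distrib-+ T (T ∘ F) ⟩
      sumᵛ T + sumᵛ (T ∘ F)                ≡⟨ cong (λ s → sumᵛ T + s) (sumᵛ-permute T F↔) ⟩
      sumᵛ T + sumᵛ T                      ≡⟨ cong (λ s → s + s) sumᵛ-T ⟩
      ((sumᵛ t + sumᵛ t) + sumᵛ t) + ((sumᵛ t + sumᵛ t) + sumᵛ t)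
                                           ≡⟨ regroup (sumᵛ t) ⟩
      (sumᵛ t + sumᵛ t) *ᶻ + 3             ≡⟨ cong (_*ᶻ + 3) 2*sumᵛ-t ⟩
      + order *ᶻ + 3                       ∎)
      where
      regroup : ∀ s → ((s + s) + s) + ((s + s) + s) ≡ (s + s) *ᶻ + 3
      regroup = solve-∀

    -- Both summands of `c` are congruent to the same `μ`, so `c` is congruent to twice `μ`.
    2∣c : + 2 ∣ c
    2∣c = subst (+ 2 ∣_) (collect (T x₀) (T (F x₀)) μ)
      (∣m∣n⇒∣m+n (∣m∣n⇒∣m+n (t-neighbours (neighbours x₀)) (t-neighbours (neighbours (F x₀))))
                 (∣n⇒∣m*n μ ∣-refl))
      where
      x₀ : Vertex
      x₀ = zero , zero
      collect : ∀ a b μ → ((a - μ) + (b - μ)) + μ *ᶻ + 2 ≡ a + b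
      collect = solve-∀

    contradictory : ⊥
    contradictory = from-no (+ 2 ∣? + 3) (subst (+ 2 ∣_) c≡3 2∣c)

theorem7 : (n : ℕ) (n≥3 : n ≥ 3) → ¬ OrientableDistanceMagic (ℤ/ (2 * n)) (path 2 □ cycle n n≥3)
theorem7 _ (s≤s 2≤m) (_ , labeling) = Prism.contradictory 2≤m labeling
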